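{- Let $c\geq 1$ be a real number and let $G$ be a finite graph with growth $f_G(r)\leq cr$ for every positive integer $r$. Then $G$ does not contain the $\lceil 2c\rceil\times\lceil 2c\rceil$ grid as a minor.
   Context: The growth of a finite graph $G$ is the function $f_G\colon\mathbb{N}\to\mathbb{N}$ where $f_G(r)$ is the maximum of $|V(H)|$ over all subgraphs $H$ of $G$ of radius at most $r$. For $n\in\mathbb{N}$, the $n\times n$ grid is the graph with vertex set $\{(v_1,v_2): v_1,v_2\in\{1,\dots,n\}\}$ where $(v_1,v_2)$ and $(u_1,u_2)$ are adjacent iff either $v_1=u_1$ and $|v_2-u_2|=1$, or $v_2=u_2$ and $|v_1-u_1|=1$. A graph $H$ is a minor of $G$ if $H$ is isomorphic to a graph obtained from a subgraph of $G$ by contracting edges. -}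

module Defs where

open import Level using (0ℓ)
open import Data.Fin.Base using (Fin; toℕ)
import Data.Fin.Properties as Fin
open import Data.Fin.Subset using (Subset; _∈_; ∣_∣; ⁅_⁆) renaming (⊥ to ∅)
open import Data.Fin.Subset.Properties
  using (_∈?_; anySubset?; ∣p∣≤n; x∈⁅x⁆; x∈⁅y⁆⇒x≡y; ∉⊥)
open import Data.Integer.Base as ℤ using (ℤ; +_)
open import Data.Nat.Base as ℕ using (ℕ; zero; suc; NonZero)
import Data.Nat.Properties as ℕ
open import Data.Product using (∃; ∃-syntax; Σ-syntax; _×_; _,_; proj₁; proj₂)
open import Data.Rational.Base as ℚ using (ℚ; _/_; _*_; 1ℚ; Positive)
import Data.Rational.Properties as ℚ
open import Data.Sum.Base using (_⊎_; inj₁; inj₂)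
open import Data.Vec.Base using (Vec; []; _∷_; lookup; replicate)
open import Data.Vec.Properties using (lookup-replicate)
open import Function.Base using (_∘_; _on_)
open import Function.Bundles using (Inverse; _⇔_; mk⇔; Equivalence)
open import Relation.Binary.Bundles using (Setoid)
open import Relation.Binary.Core using (Rel; _⇒_)
open import Relation.Binary.Definitions using (Decidable; Symmetric; _Respects₂_; tri<; tri≈; tri>)
open import Relation.Binary.Construct.Closure.Equivalence as Eq using (EqClosure)
import Relation.Binary.Construct.On as On
open import Relation.Binary.PropositionalEquality
  using (_≡_; refl; sym; trans; cong; subst) renaming (setoid to ≡-setoid)
import Relation.Unary as U
open import Relation.Nullary using (Dec; yes; no; ¬_; contradiction)
open import Relation.Nullary.Decidable using (map′; _×-dec_; _→-dec_)

-- Located two-sided Dedekind cuts; equality of reals is _≤_ in both directions.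
record ℝ : Set₁ where
  field
    L U         : ℚ → Set
    L-inhabited : ∃ L
    U-inhabited : ∃ U
    L-rounded   : ∀ q → L q ⇔ (∃[ p ] q ℚ.< p × L p)
    U-rounded   : ∀ q → U q ⇔ (∃[ p ] p ℚ.< q × U p)
    disjoint    : ∀ q → ¬ (L q × U q)
    located     : ∀ {p q} → p ℚ.< q → L p ⊎ U q

infix 4 _≤_

_≤_ : ℝ → ℝ → Set
x ≤ y = ∀ q → ℝ.L x q → ℝ.L y q

private
  q-1<q : ∀ q → q ℚ.- 1ℚ ℚ.< q
  q-1<q q = subst (q ℚ.- 1ℚ ℚ.<_) (ℚ.+-identityʳ q) (ℚ.+-monoʳ-< q (ℚ.negative⁻¹ (ℚ.- 1ℚ)))

  q<q+1 : ∀ q → q ℚ.< q ℚ.+ 1ℚ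
  q<q+1 q = subst (ℚ._< q ℚ.+ 1ℚ) (ℚ.+-identityʳ q) (ℚ.+-monoʳ-< q (ℚ.positive⁻¹ 1ℚ))

fromℚ : ℚ → ℝ
fromℚ a = record
  { L           = ℚ._< a
  ; U           = a ℚ.<_
  ; L-inhabited = a ℚ.- 1ℚ , q-1<q a
  ; U-inhabited = a ℚ.+ 1ℚ , q<q+1 a
  ; L-rounded   = λ q → mk⇔ ℚ.<-dense λ (_ , q<p , p<a) → ℚ.<-trans q<p p<a
  ; U-rounded   = λ q → mk⇔
      (λ a<q → let p , a<p , p<q = ℚ.<-dense a<q in p , p<q , a<p)
      (λ (_ , p<q , a<p) → ℚ.<-trans a<p p<q)
  ; disjoint    = λ q (q<a , a<q) → ℚ.<-asym q<a a<q
  ; located     = located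
  }
  where
  located : ∀ {p q} → p ℚ.< q → p ℚ.< a ⊎ a ℚ.< q
  located {p} p<q with ℚ.<-cmp p a
  ... | tri< p<a _ _    = inj₁ p<a
  ... | tri≈ _ refl _   = inj₂ p<q
  ... | tri> _ _ a<p    = inj₂ (ℚ.<-trans a<p p<q)

fromℤ : ℤ → ℝ
fromℤ i = fromℚ (i / 1)

fromℕ : ℕ → ℝ
fromℕ n = fromℤ (+ n)

infixl 7 _·_

-- The product of a positive natural number and a real: q < n · x iff q / n < x.
_·_ : (n : ℕ) .{{_ : NonZero n}} → ℝ → ℝ
n@(suc _) · x = record
  { L           = L ∘ (_* n⁻¹)
  ; U           = U ∘ (_* n⁻¹)
  ; L-inhabited = let q , Lq = L-inhabited in q * n′ , subst L (sym (*n/n q)) Lq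
  ; U-inhabited = let q , Uq = U-inhabited in q * n′ , subst U (sym (*n/n q)) Uq
  ; L-rounded   = λ q → mk⇔
      (λ Lq → let p , q<p , Lp = Equivalence.to (L-rounded _) Lq in
         p * n′ , subst (ℚ._< p * n′) (/n*n q) (ℚ.*-monoˡ-<-pos n′ q<p) , subst L (sym (*n/n p)) Lp)
      (λ (p , q<p , Lp) →
         Equivalence.from (L-rounded _) (p * n⁻¹ , ℚ.*-monoˡ-<-pos n⁻¹ q<p , Lp))
  ; U-rounded   = λ q → mk⇔
      (λ Uq → let p , p<q , Up = Equivalence.to (U-rounded _) Uq in
         p * n′ , subst (p * n′ ℚ.<_) (/n*n q) (ℚ.*-monoˡ-<-pos n′ p<q) , subst U (sym (*n/n p)) Up)
      (λ (p , p<q , Up) →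
         Equivalence.from (U-rounded _) (p * n⁻¹ , ℚ.*-monoˡ-<-pos n⁻¹ p<q , Up))
  ; disjoint    = λ q → disjoint (q * n⁻¹)
  ; located     = λ p<q → located (ℚ.*-monoˡ-<-pos n⁻¹ p<q)
  }
  where
  open ℝ x
  n′ n⁻¹ : ℚ
  n′ = + n / 1
  instance
    n′-pos : Positive n′
    n′-pos = ℚ.normalize-pos n 1
    n′-nonZero : ℚ.NonZero n′
    n′-nonZero = ℚ.pos⇒nonZero n′
  n⁻¹ = ℚ.1/ n′
  instance
    n⁻¹-pos : Positive n⁻¹
    n⁻¹-pos = ℚ.1/pos⇒pos n′
  *n/n : ∀ q → q * n′ * n⁻¹ ≡ q
  *n/n q = trans (ℚ.*-assoc q n′ n⁻¹) (trans (cong (q *_) (ℚ.*-inverseʳ n′)) (ℚ.*-identityʳ q))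
  /n*n : ∀ q → q * n⁻¹ * n′ ≡ q
  /n*n q = trans (ℚ.*-assoc q n⁻¹ n′) (trans (cong (q *_) (ℚ.*-inverseˡ n′)) (ℚ.*-identityʳ q))

-- ⌈ x ⌉ ≡ k, i.e. k is the least integer that is at least x.  It is a relation
-- because the ceiling is not a computable function of a real number.
IsCeiling : ℝ → ℤ → Set
IsCeiling x k = x ≤ fromℤ k × (∀ j → x ≤ fromℤ j → k ℤ.≤ j)

-- Vertices form a setoid, so that contraction can be a quotient.
record Graph : Set₁ where
  infix 4 _~_
  field
    vertices : Setoid 0ℓ 0ℓ
  open Setoid vertices public using (_≈_) renaming (Carrier to V)
  field
    _~_      : Rel V 0ℓ
    ~-resp-≈ : _~_ Respects₂ _≈_
    ~-sym    : Symmetric _~_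
    ~-irrefl : ∀ {x y} → x ≈ y → ¬ x ~ y

record _≅_ (G H : Graph) : Set where
  private
    module G = Graph G
    module H = Graph H
  field
    bijection : Inverse G.vertices H.vertices
  open Inverse bijection public
  field
    ~⇔~ : ∀ x y → x G.~ y ⇔ to x H.~ to y

-- Walk _≈_ _~_ l x y : a walk with l edges from x to y.
data Walk {V : Set} (_≈_ _~_ : Rel V 0ℓ) : ℕ → V → V → Set where
  stop : ∀ {x y} → x ≈ y → Walk _≈_ _~_ zero x y
  step : ∀ {l x y z} → x ~ y → Walk _≈_ _~_ l y z → Walk _≈_ _~_ (suc l) x z

DistanceAtMost : (G : Graph) → ℕ → Rel (Graph.V G) 0ℓ
DistanceAtMost G r x y = ∃[ l ] l ℕ.≤ r × Walk (Graph._≈_ G) (Graph._~_ G) l x y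

RadiusAtMost : Graph → ℕ → Set
RadiusAtMost G r = ∃[ x ] ∀ y → DistanceAtMost G r x y

-- contract G S contracts the edges in S: its vertices are the components of the
-- spanning subgraph of G with edge set S, and two distinct components are
-- adjacent when G has an edge between them.
module _ (G : Graph) (S : Rel (Graph.V G) 0ℓ) where
  open Graph G

  SameComponent : Rel V 0ℓ
  SameComponent = EqClosure (λ x y → x ≈ y ⊎ S x y)

  private module C = Setoid (Eq.setoid (λ x y → x ≈ y ⊎ S x y))

  contract : Graph
  contract = record
    { vertices = record { isEquivalence = C.isEquivalence }
    ; _~_      = λ x y → ¬ SameComponent x y ×
                   (∃[ x′ ] ∃[ y′ ] SameComponent x x′ × SameComponent y y′ × x′ ~ y′)
    ; ~-resp-≈ =
        (λ y≈z (x≉y , x′ , y′ , xx′ , yy′ , e) →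
           (λ x≈z → x≉y (C.trans x≈z (C.sym y≈z))) , x′ , y′ , xx′ , C.trans (C.sym y≈z) yy′ , e)
      , (λ x≈z (x≉y , x′ , y′ , xx′ , yy′ , e) →
           (λ z≈y → x≉y (C.trans x≈z z≈y)) , x′ , y′ , C.trans (C.sym x≈z) xx′ , yy′ , e)
    ; ~-sym    = λ (x≉y , x′ , y′ , xx′ , yy′ , e) →
        (λ y≈x → x≉y (C.sym y≈x)) , y′ , x′ , yy′ , xx′ , ~-sym e
    ; ~-irrefl = λ x≈y (x≉y , _) → x≉y x≈y
    }

grid : ℕ → Graph
grid n = record
  { vertices = ≡-setoid (Fin n × Fin n)
  ; _~_      = _~_
  ; ~-resp-≈ = (λ { refl e → e }) , (λ { refl e → e })
  ; ~-sym    = λ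
      { {v₁ , v₂} {u₁ , u₂} (inj₁ (p , q)) → inj₁ (sym p , trans (ℕ.∣-∣-comm (toℕ u₂) (toℕ v₂)) q)
      ; {v₁ , v₂} {u₁ , u₂} (inj₂ (p , q)) → inj₂ (sym p , trans (ℕ.∣-∣-comm (toℕ u₁) (toℕ v₁)) q)
      }
  ; ~-irrefl = λ
      { {v₁ , v₂} refl (inj₁ (_ , q)) → 0≢1 (trans (sym (ℕ.∣n-n∣≡0 (toℕ v₂))) q)
      ; {v₁ , v₂} refl (inj₂ (_ , q)) → 0≢1 (trans (sym (ℕ.∣n-n∣≡0 (toℕ v₁))) q)
      }
  }
  where
  _~_ : Rel (Fin n × Fin n) 0ℓ
  (v₁ , v₂) ~ (u₁ , u₂) =
    (v₁ ≡ u₁ × ℕ.∣ toℕ v₂ - toℕ u₂ ∣ ≡ 1) ⊎ (v₂ ≡ u₂ × ℕ.∣ toℕ v₁ - toℕ u₁ ∣ ≡ 1)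
  0≢1 : ¬ 0 ≡ 1
  0≢1 ()

record FiniteGraph : Set₁ where
  infix 4 _~_ _~?_
  field
    order    : ℕ
    _~_      : Rel (Fin order) 0ℓ
    _~?_     : Decidable _~_
    ~-sym    : Symmetric _~_
    ~-irrefl : ∀ {x} → ¬ x ~ x

module _ (G : FiniteGraph) where
  open FiniteGraph G

  -- Row x of the adjacency matrix of a subgraph is the neighbourhood of x in it.
  Edge : Vec (Subset order) order → Rel (Fin order) 0ℓ
  Edge N x y = y ∈ lookup N x

  record IsSubgraph (W : Subset order) (N : Vec (Subset order) order) : Set where
    field
      edge-sym  : ∀ x y → Edge N x y → Edge N y x
      edge⇒∈    : ∀ x y → Edge N x y → x ∈ W
      edge⇒~    : ∀ x y → Edge N x y → x ~ y

  record Subgraph : Set where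
    constructor mkSubgraph
    field
      W          : Subset order
      N          : Vec (Subset order) order
      isSubgraph : IsSubgraph W N
    open IsSubgraph isSubgraph public

module _ {G : FiniteGraph} where
  open FiniteGraph G using (order)

  ∣V_∣ : Subgraph G → ℕ
  ∣V H ∣ = ∣ Subgraph.W H ∣

  toGraph : Subgraph G → Graph
  toGraph H = record
    { vertices = On.setoid (≡-setoid (Fin order)) (proj₁ {B = _∈ W})
    ; _~_      = Edge G N on proj₁
    ; ~-resp-≈ = (λ { refl e → e }) , (λ { refl e → e })
    ; ~-sym    = edge-sym _ _
    ; ~-irrefl = λ { refl e → FiniteGraph.~-irrefl G (edge⇒~ _ _ e) }
    }
    where open Subgraph H

infix 4 _MinorOf_

_MinorOf_ : Graph → FiniteGraph → Set₁
K MinorOf G =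
  Σ[ H ∈ Subgraph G ] Σ[ S ∈ Rel (Graph.V (toGraph H)) 0ℓ ]
    (S ⇒ Graph._~_ (toGraph H)) × K ≅ contract (toGraph H) S

module _ (G : FiniteGraph) where
  open FiniteGraph G

  HasSubgraph : ℕ → ℕ → Set
  HasSubgraph r m = Σ[ H ∈ Subgraph G ] RadiusAtMost (toGraph H) r × ∣V H ∣ ≡ m

  private
    anyVec? : ∀ {k} {P : Vec (Subset order) k → Set} → U.Decidable P → Dec (∃ P)
    anyVec? {zero}  P? = map′ ([] ,_) (λ { ([] , p) → p }) (P? [])
    anyVec? {suc k} P? =
      map′ (λ (s , v , p) → s ∷ v , p) (λ { (s ∷ v , p) → s , v , p })
           (anySubset? λ s → anyVec? λ v → P? (s ∷ v))

    isSubgraph? : ∀ W N → Dec (IsSubgraph G W N)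
    isSubgraph? W N =
      map′ (λ (a , b , c) → record { edge-sym = a ; edge⇒∈ = b ; edge⇒~ = c })
           (λ i → let open IsSubgraph i in edge-sym , edge⇒∈ , edge⇒~)
           (all₂? (λ x y → edge? x y →-dec edge? y x)
             ×-dec all₂? (λ x y → edge? x y →-dec x ∈? W)
             ×-dec all₂? (λ x y → edge? x y →-dec x ~? y))
      where
      edge? : Decidable (Edge G N)
      edge? x y = y ∈? lookup N x
      all₂? : {P : Rel (Fin order) 0ℓ} → Decidable P → Dec (∀ x y → P x y)
      all₂? P? = Fin.all? λ x → Fin.all? λ y → P? x y

    module _ (H : Subgraph G) where
      open Subgraph H
      private module H = Graph (toGraph H)

      anyVertex? : {P : H.V → Set} → (∀ x {p q} → P (x , p) → P (x , q)) →
                   U.Decidable P → Dec (∃ P)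
      anyVertex? {P} P-irr P? = map′
        (λ (x , x∈W , p) → (x , x∈W) , p) (λ ((x , x∈W) , p) → x , x∈W , p)
        (Fin.any? λ x → vertex? x (x ∈? W))
        where
        vertex? : ∀ x → Dec (x ∈ W) → Dec (∃[ x∈W ] P (x , x∈W))
        vertex? x (no x∉W)  = no (x∉W ∘ proj₁)
        vertex? x (yes x∈W) = map′ (x∈W ,_) (P-irr x ∘ proj₂) (P? (x , x∈W))

      allVertices? : {P : H.V → Set} → (∀ x {p q} → P (x , p) → P (x , q)) →
                     U.Decidable P → Dec (∀ x → P x)
      allVertices? {P} P-irr P? = map′
        (λ f (x , x∈W) → f x x∈W) (λ f x x∈W → f (x , x∈W))
        (Fin.all? λ x → vertex? x (x ∈? W))
        where
        vertex? : ∀ x → Dec (x ∈ W) → Dec (∀ x∈W → P (x , x∈W))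
        vertex? x (no x∉W)  = yes λ x∈W → contradiction x∈W x∉W
        vertex? x (yes x∈W) = map′ (λ p _ → P-irr x p) (λ f → f x∈W) (P? (x , x∈W))

      Walkᴴ : ℕ → Rel H.V 0ℓ
      Walkᴴ = Walk H._≈_ H._~_

      walk-irrˡ : ∀ {l x p q z} → Walkᴴ l (x , p) z → Walkᴴ l (x , q) z
      walk-irrˡ (stop e)   = stop e
      walk-irrˡ (step e w) = step e w

      walk-irrʳ : ∀ {l x y p q} → Walkᴴ l x (y , p) → Walkᴴ l x (y , q)
      walk-irrʳ (stop e)   = stop e
      walk-irrʳ (step e w) = step e (walk-irrʳ w)

      walk? : ∀ l → Decidable (Walkᴴ l)
      walk? zero    (x , _) (y , _) = map′ stop (λ { (stop e) → e }) (x Fin.≟ y)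
      walk? (suc l) (x , _) z       = map′
        (λ (_ , e , w) → step e w) (λ { (step e w) → _ , e , w })
        (anyVertex? (λ _ (e , w) → e , walk-irrˡ w)
                    (λ y → proj₁ y ∈? lookup N x ×-dec walk? l y z))

      radius? : ∀ r → Dec (RadiusAtMost (toGraph H) r)
      radius? r =
        anyVertex? (λ _ f y → let l , l≤r , w = f y in l , l≤r , walk-irrˡ w) λ x →
        allVertices? (λ _ (l , l≤r , w) → l , l≤r , walk-irrʳ w) λ y →
        map′ (λ (l , l<1+r , w) → l , ℕ.s≤s⁻¹ l<1+r , w) (λ (l , l≤r , w) → l , ℕ.s≤s l≤r , w)
             (ℕ.anyUpTo? (λ l → walk? l x y) (suc r))

  hasSubgraph? : ∀ r m → Dec (HasSubgraph r m)
  hasSubgraph? r m = map′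
    (λ (W , N , i , p) → mkSubgraph W N i , p)
    (λ (mkSubgraph W N i , p) → W , N , i , p)
    (anySubset? λ W → anyVec? λ N → with-proof W N (isSubgraph? W N))
    where
    with-proof : ∀ W N → Dec (IsSubgraph G W N) →
      Dec (Σ[ i ∈ IsSubgraph G W N ] RadiusAtMost (toGraph (mkSubgraph {G} W N i)) r × ∣ W ∣ ≡ m)
    with-proof W N (no ¬i) = no (¬i ∘ proj₁)
    with-proof W N (yes i) =
      map′ (i ,_) proj₂ (radius? (mkSubgraph W N i) r ×-dec (∣ W ∣ ℕ.≟ m))

-- The greatest m ≤ b with P m, or 0 if there is none.
greatest : {P : ℕ → Set} → U.Decidable P → ℕ → ℕ
greatest P? zero    = zero
greatest P? (suc b) with P? (suc b)
... | yes _ = suc b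
... | no  _ = greatest P? b

-- The maximum of ∣V H ∣ over the subgraphs H of G of radius at most r
-- (0 if G has no vertices).
growth : FiniteGraph → ℕ → ℕ
growth G r = greatest (hasSubgraph? G r) (FiniteGraph.order G)

greatest-upper : {P : ℕ → Set} (P? : U.Decidable P) → ∀ b {m} → m ℕ.≤ b → P m → m ℕ.≤ greatest P? b
greatest-upper P? zero    m≤b p = m≤b
greatest-upper P? (suc b) m≤b p with P? (suc b)
... | yes _  = m≤b
... | no ¬p  = greatest-upper P? b (ℕ.s≤s⁻¹ (ℕ.≤∧≢⇒< m≤b λ { refl → ¬p p })) p

greatest-attained : {P : ℕ → Set} (P? : U.Decidable P) → ∀ b {m} → m ℕ.≤ b → P m → P (greatest P? b)
greatest-attained P? zero    ℕ.z≤n p = p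
greatest-attained P? (suc b) m≤b   p with P? (suc b)
... | yes q  = q
... | no ¬p  = greatest-attained P? b (ℕ.s≤s⁻¹ (ℕ.≤∧≢⇒< m≤b λ { refl → ¬p p })) p

growth-upper : ∀ G r (H : Subgraph G) → RadiusAtMost (toGraph H) r → ∣V H ∣ ℕ.≤ growth G r
growth-upper G r H rad =
  greatest-upper (hasSubgraph? G r) _ (∣p∣≤n (Subgraph.W H)) (H , rad , refl)

growth-attained : ∀ G r → Fin (FiniteGraph.order G) →
  Σ[ H ∈ Subgraph G ] RadiusAtMost (toGraph H) r × ∣V H ∣ ≡ growth G r
growth-attained G r x =
  greatest-attained (hasSubgraph? G r) _ (∣p∣≤n (Subgraph.W K₁)) (K₁ , rad , refl)
  where
  open FiniteGraph G
  no-edge : ∀ y z → ¬ Edge G (replicate order ∅) y z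
  no-edge y z e = ∉⊥ (subst (z ∈_) (lookup-replicate y ∅) e)
  K₁ : Subgraph G
  K₁ = mkSubgraph ⁅ x ⁆ (replicate order ∅) record
    { edge-sym = λ y z e → contradiction e (no-edge y z)
    ; edge⇒∈   = λ y z e → contradiction e (no-edge y z)
    ; edge⇒~   = λ y z e → contradiction e (no-edge y z)
    }
  rad : RadiusAtMost (toGraph K₁) r
  rad = (x , x∈⁅x⁆ x) , λ (y , y∈) → 0 , ℕ.z≤n , stop (sym (x∈⁅y⁆⇒x≡y x y∈))

{-# OPTIONS --safe #-}
module Submission where

open import Defs
open import Data.Nat.Base using (ℕ; NonZero)
open import Data.Integer.Base using (+_)
open import Relation.Nullary using (¬_)

open import Data.Fin.Base as Fin using (Fin; zero; suc; toℕ; combine; remQuot)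
import Data.Fin.Properties as Fin
open import Data.Fin.Subset using (Subset; _∈_; ∣_∣)
open import Data.Fin.Subset.Properties using (_∈?_; x∈p∧x≢y⇒x∈p-y; x∈p⇒∣p-x∣<∣p∣)
import Data.Integer.Base as ℤ
import Data.Integer.Properties as ℤ
open import Data.Nat.Base as ℕ using (suc; z≤n; s≤s; ⌈_/2⌉; ⌊_/2⌋; _*_)
open import Data.Nat.Induction using (<-rec)
import Data.Nat.Properties as ℕ
open import Data.Nat.Solver using (module +-*-Solver)
open import Data.Product using (∃; ∃-syntax; Σ-syntax; _×_; _,_; proj₁; proj₂)
open import Data.Product.Properties using (≡-dec)
import Data.Rational.Base as ℚ
import Data.Rational.Properties as ℚ
import Data.Rational.Unnormalised.Base as ℚᵘ
import Data.Rational.Unnormalised.Properties as ℚᵘ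
open import Data.Sum.Base using (_⊎_; inj₁; inj₂; [_,_]′)
open import Data.Vec.Base using (tabulate; lookup)
open import Data.Vec.Properties using (lookup∘tabulate; lookup⇒[]=; []=⇒lookup)
open import Data.Vec.Properties.WithK using ([]=-irrelevant)
open import Function.Base using (_∘_; id; flip; it)
open import Function.Bundles using (Equivalence)
open import Level using (0ℓ)
open import Relation.Binary.Bundles using (Setoid)
open import Relation.Binary.Construct.Closure.ReflexiveTransitive
  using (Star; ε; _◅_; _◅◅_; gmap; kleisliStar; reverse)
open import Relation.Binary.Construct.Closure.Symmetric using (fwd; bwd)
open import Relation.Binary.Core using (Rel; _⇒_)
open import Relation.Binary.Definitions using (Decidable; DecidableEquality)
open import Relation.Binary.PropositionalEquality
  using (_≡_; refl; sym; trans; cong; cong₂; subst; module ≡-Reasoning)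
open import Relation.Nullary using (Dec; yes; no; does; contradiction)
open import Relation.Nullary.Decidable
  using (map′; _×-dec_; _⊎-dec_; dec-true; decidable-stable; ¬?)
import Relation.Unary as U

-- A grid model maps the vertices of a subgraph H of G onto the grid.  Take a
-- walk P in H of least length l among those joining opposite sides of the grid;
-- say it crosses the rows.  Put m = ⌈ l / 2 ⌉ and let z be the midpoint of P.
-- P meets every row j, at a vertex pⱼ within distance m of z.  The row j is
-- connected and contains both ends of a walk crossing the columns, so by
-- minimality of l the spheres of radius 0, …, m around pⱼ inside the row are
-- all nonempty.  The ball of radius 2m around z thus has at least k (m + 1)
-- vertices, whereas the growth is at most 2mc ≤ mk.

-- Subsets given by decidable predicates, and counting by injections.

module _ {n : ℕ} {P : Fin n → Set} (P? : U.Decidable P) where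

  ⟦_⟧ : Subset n
  ⟦_⟧ = tabulate (does ∘ P?)

  ∈⟦⟧⁺ : ∀ {x} → P x → x ∈ ⟦_⟧
  ∈⟦⟧⁺ {x} p = lookup⇒[]= x _ (trans (lookup∘tabulate _ x) (dec-true (P? x) p))

  ∈⟦⟧⁻ : ∀ {x} → x ∈ ⟦_⟧ → P x
  ∈⟦⟧⁻ {x} x∈ with P? x | trans (sym (lookup∘tabulate (does ∘ P?) x)) ([]=⇒lookup x∈)
  ... | yes p | _  = p
  ... | no  _ | ()

injection⇒≤∣p∣ : ∀ {n q} {p : Subset n} (f : Fin q → Fin n) →
  (∀ {i j} → f i ≡ f j → i ≡ j) → (∀ i → f i ∈ p) → q ℕ.≤ ∣ p ∣
injection⇒≤∣p∣ {q = ℕ.zero} f f-inj f∈p = z≤n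
injection⇒≤∣p∣ {q = suc q}  f f-inj f∈p = ℕ.≤-<-trans
  (injection⇒≤∣p∣ (f ∘ suc) (Fin.suc-injective ∘ f-inj)
    λ i → x∈p∧x≢y⇒x∈p-y (f∈p (suc i)) (Fin.0≢1+n ∘ sym ∘ f-inj))
  (x∈p⇒∣p-x∣<∣p∣ (f∈p zero))

-- Balls and spheres of a searchable relation.

Searchable : Set → Set₁
Searchable V = ∀ {P : V → Set} → U.Decidable P → Dec (∃ P)

module _ {V : Set} (R : Rel V 0ℓ) (p : V) where

  -- `R` is not assumed symmetric: the steps within a line, `StepInto`, constrain only their target.
  Ball : ℕ → V → Set
  Ball ℕ.zero  y = p ≡ y
  Ball (suc r) y = Ball r y ⊎ (∃[ x ] Ball r x × R x y)

  ball-mono : ∀ {r s y} → r ℕ.≤ s → Ball r y → Ball s y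
  ball-mono = go ∘ ℕ.≤⇒≤′
    where
    go : ∀ {r s y} → r ℕ.≤′ s → Ball r y → Ball s y
    go (ℕ.≤′-reflexive refl) b = b
    go (ℕ.≤′-step r≤s)       b = inj₁ (go r≤s b)

  ball? : Searchable V → DecidableEquality V → Decidable R → ∀ r → U.Decidable (Ball r)
  ball? any? _≟_ R? ℕ.zero  y = p ≟ y
  ball? any? _≟_ R? (suc r) y =
    ball? any? _≟_ R? r y ⊎-dec any? λ x → ball? any? _≟_ R? r x ×-dec R? x y

  Sphere : ℕ → V → Set
  Sphere r y = Ball r y × (∀ {s} → s ℕ.< r → ¬ Ball s y)

  sphere-radius-unique : ∀ {r s y} → Sphere r y → Sphere s y → r ≡ s
  sphere-radius-unique (b , out) (b′ , out′) =
    ℕ.≤-antisym (ℕ.≮⇒≥ λ s<r → out s<r b′) (ℕ.≮⇒≥ λ r<s → out′ r<s b)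

  -- If the next sphere is empty, the ball has filled the component of p.
  sphere-or-component : Searchable V → DecidableEquality V → Decidable R → ∀ r →
    (∃[ y ] Sphere (suc r) y) ⊎ (∀ {y} → Star R p y → Ball r y)
  sphere-or-component any? _≟_ R? r
    with any? (λ y → ball? any? _≟_ R? (suc r) y ×-dec ¬? (ball? any? _≟_ R? r y))
  ... | yes (y , b , ¬b) = inj₁ (y , b , λ s<1+r b′ → ¬b (ball-mono (ℕ.s≤s⁻¹ s<1+r) b′))
  ... | no ¬next = inj₂ (closed (ball-mono z≤n refl))
    where
    closed : ∀ {x y} → Ball r x → Star R x y → Ball r y
    closed b ε        = b
    closed b (s ◅ ss) = closed
      (decidable-stable (ball? any? _≟_ R? r _) λ ¬b → ¬next (_ , inj₂ (_ , b , s) , ¬b)) ss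

-- Walks and distances in a graph.

module _ (G : Graph) where
  open Graph G
  private module V = Setoid vertices

  walk-respˡ : ∀ {l x y z} → x ≈ y → Walk _≈_ _~_ l y z → Walk _≈_ _~_ l x z
  walk-respˡ e (stop e′)  = stop (V.trans e e′)
  walk-respˡ e (step s w) = step (proj₂ ~-resp-≈ (V.sym e) s) w

  walk-++ : ∀ {l m x y z} → Walk _≈_ _~_ l x y → Walk _≈_ _~_ m y z → Walk _≈_ _~_ (l ℕ.+ m) x z
  walk-++ (stop e)   w = walk-respˡ e w
  walk-++ (step s v) w = step s (walk-++ v w)

  distance-refl : ∀ {r x} → DistanceAtMost G r x x
  distance-refl = 0 , z≤n , stop V.refl

  distance-trans : ∀ {r s x y z} →
    DistanceAtMost G r x y → DistanceAtMost G s y z → DistanceAtMost G (r ℕ.+ s) x z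
  distance-trans (_ , l≤r , v) (_ , m≤s , w) = _ , ℕ.+-mono-≤ l≤r m≤s , walk-++ v w

  distance-mono : ∀ {r s x y} → r ℕ.≤ s → DistanceAtMost G r x y → DistanceAtMost G s x y
  distance-mono r≤s (l , l≤r , w) = l , ℕ.≤-trans l≤r r≤s , w

  distance-snoc : ∀ {r x y z} → DistanceAtMost G r x y → y ~ z → DistanceAtMost G (suc r) x z
  distance-snoc {r} {x} {z = z} d s = subst (λ r → DistanceAtMost G r x z) (ℕ.+-comm r 1)
    (distance-trans d (1 , ℕ.≤-refl , step s (stop V.refl)))

  distance-sym : ∀ {r x y} → DistanceAtMost G r x y → DistanceAtMost G r y x
  distance-sym (_ , l≤r , w) = distance-mono l≤r (go w)
    where
    go : ∀ {l x y} → Walk _≈_ _~_ l x y → DistanceAtMost G l y x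
    go (stop e)   = 0 , z≤n , stop (V.sym e)
    go (step s w) = distance-snoc (go w) (~-sym s)

  -- Injectivity is up to `_≡_`; for a subgraph this agrees with `_≈_` by `vertex-≡`.
  Cluster : ℕ → ℕ → Set
  Cluster q r = ∃[ z ] Σ[ y ∈ (Fin q → V) ]
    (∀ {i j} → y i ≡ y j → i ≡ j) × (∀ i → DistanceAtMost G r z (y i))

  ball⇒distance : ∀ {R : Rel V 0ℓ} → R ⇒ _~_ → ∀ {p} r {y} → Ball R p r y → DistanceAtMost G r p y
  ball⇒distance R⇒~ ℕ.zero  refl               = distance-refl
  ball⇒distance R⇒~ (suc r) (inj₁ b)           = distance-mono (ℕ.n≤1+n r) (ball⇒distance R⇒~ r b)
  ball⇒distance R⇒~ (suc r) (inj₂ (_ , b , s)) = distance-snoc (ball⇒distance R⇒~ r b) (R⇒~ s)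

  split-walk : ∀ a {b x y} → Walk _≈_ _~_ (a ℕ.+ b) x y →
    ∃[ z ] Walk _≈_ _~_ a x z × Walk _≈_ _~_ b z y
  split-walk ℕ.zero  w          = _ , stop V.refl , w
  split-walk (suc a) (step s w) = let z , u , v = split-walk a w in z , step s u , v

  Lipschitz : (V → ℕ) → Set
  Lipschitz f = ∀ {x y} → x ~ y → f y ℕ.≤ suc (f x)

  -- While `f` is below `j`, one step raises it by at most one, so it cannot jump over `j`.
  -- Distances to both ends are recorded because the midpoint of a crossing is the end of one half
  -- and the start of the other.
  intermediate-value : (f : V → ℕ) → (∀ {x y} → x ≈ y → f y ℕ.≤ f x) → Lipschitz f →
    ∀ {l x y j} → Walk _≈_ _~_ l x y → f x ℕ.≤ j → j ℕ.≤ f y →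
    ∃[ p ] f p ≡ j × DistanceAtMost G l x p × DistanceAtMost G l p y
  intermediate-value f f-resp f-lip {x = x} {j = j} w fx≤j j≤fy with f x ℕ.≟ j
  ... | yes fx≡j = x , fx≡j , distance-refl , (_ , ℕ.≤-refl , w)
  intermediate-value f f-resp f-lip (stop e) fx≤j j≤fy | no fx≢j =
    contradiction (ℕ.≤-antisym fx≤j (ℕ.≤-trans j≤fy (f-resp e))) fx≢j
  intermediate-value f f-resp f-lip (step s w) fx≤j j≤fy | no fx≢j
    with p , fp≡j , (_ , l≤ , v) , d ←
      intermediate-value f f-resp f-lip w
        (ℕ.≤-trans (f-lip s) (ℕ.≤∧≢⇒< fx≤j fx≢j)) j≤fy
    = p , fp≡j , (_ , s≤s l≤ , step s v) , distance-mono (ℕ.n≤1+n _) d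

  star⇒walk : ∀ {R : Rel V 0ℓ} → R ⇒ _~_ → ∀ {x y} → Star R x y → ∃[ l ] Walk _≈_ _~_ l x y
  star⇒walk R⇒~ ε        = 0 , stop V.refl
  star⇒walk R⇒~ (s ◅ ss) = let l , w = star⇒walk R⇒~ ss in suc l , step (R⇒~ s) w

-- Crossings of a family of lines, and the vertices near a shortest one.

i<⌈l/2⌉⇒i+i<l : ∀ {i l} → i ℕ.< ⌈ l /2⌉ → i ℕ.+ i ℕ.< l
i<⌈l/2⌉⇒i+i<l {i} {l} i<⌈l/2⌉ = ℕ.≰⇒> λ l≤i+i →
  ℕ.<⇒≱ i<⌈l/2⌉ (subst (⌈ l /2⌉ ℕ.≤_) (sym (ℕ.n≡⌈n+n/2⌉ i)) (ℕ.⌈n/2⌉-mono l≤i+i))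

module _ (G : Graph) {n : ℕ} where
  open Graph G

  -- A path of such steps stays in line `j` as soon as its start lies there.
  StepInto : (V → Fin (suc n)) → Fin (suc n) → Rel V 0ℓ
  StepInto f j x y = x ~ y × f y ≡ j

  Crossing : (V → Fin (suc n)) → ℕ → Set
  Crossing f l = ∃[ x ] ∃[ y ] f x ≡ zero × f y ≡ Fin.fromℕ n × Walk _≈_ _~_ l x y

  -- f numbers the lines of the grid, g the position within a line.
  record Lines (f g : V → Fin (suc n)) : Set where
    field
      lipschitz : Lipschitz G (toℕ ∘ f)
      connected : ∀ {x y} → f x ≡ f y → Star (StepInto f (f x)) x y
      point     : ∀ j i → ∃[ x ] f x ≡ j × g x ≡ i

  -- Line `zero` is connected and contains a point at each end position.
  crossing-exists : ∀ {f g} → Lines f g → ∃ (Crossing g)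
  crossing-exists lines =
    let open Lines lines
        x , fx , gx = point zero zero
        y , fy , gy = point zero (Fin.fromℕ n)
        l , w       = star⇒walk G proj₁ (connected (trans fx (sym fy)))
    in l , x , y , gx , gy , w

  module _ (≈⇒≡ : ∀ {x y} → x ≈ y → x ≡ y)
           (any? : Searchable V) (_≟_ : DecidableEquality V) (_~?_ : Decidable _~_)
           {f g : V → Fin (suc n)} (lines : Lines f g) where
    open Lines lines

    -- The minimality hypothesis concerns `g`: a line of `f` whose spheres run out before radius
    -- `⌈ l /2⌉` would contain a `g`-crossing shorter than `l`.
    shortest-crossing⇒cluster : ∀ {l} → (∀ {l′} → l′ ℕ.< l → ¬ Crossing g l′) → Crossing f l →
      Cluster G (suc n * suc ⌈ l /2⌉) (⌈ l /2⌉ ℕ.+ ⌈ l /2⌉)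
    shortest-crossing⇒cluster {l} no-shorter (x₀ , x₁ , fx₀ , fx₁ , w) =
      z , choice , injective , λ i →
        -- At most `m` from `z` to the foot of the line, and at most `m` from there to the chosen
        -- vertex.
        distance-trans G (distance-sym G (foot-near (line i)))
          (distance-mono G (Fin.toℕ≤pred[n] (height i))
            (ball⇒distance G proj₁ _ (proj₁ (on-sphere (line i) (height i)))))
      where
      m : ℕ
      m = ⌈ l /2⌉

      halves : ∃[ z ] Walk _≈_ _~_ ⌊ l /2⌋ x₀ z × Walk _≈_ _~_ m z x₁
      -- The longer half comes second, so both halves have length at most `m`.
      halves = split-walk G ⌊ l /2⌋ (subst (λ l → Walk _≈_ _~_ l x₀ x₁) (sym (ℕ.⌊n/2⌋+⌈n/2⌉≡n l)) w)

      z : V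
      z = proj₁ halves

      crosses : ∀ {l x y j} → Walk _≈_ _~_ l x y → toℕ (f x) ℕ.≤ toℕ j → toℕ j ℕ.≤ toℕ (f y) →
        ∃[ p ] f p ≡ j × DistanceAtMost G l x p × DistanceAtMost G l p y
      crosses w ≤j j≤ =
        let p , fp , ds = intermediate-value G (toℕ ∘ f)
              (λ e → ℕ.≤-reflexive (cong (toℕ ∘ f) (sym (≈⇒≡ e)))) lipschitz w ≤j j≤
        in p , Fin.toℕ-injective fp , ds

      foot : ∀ j → ∃[ p ] f p ≡ j × DistanceAtMost G m p z
      -- The half from `x₀` to `z` starts in line `zero`, so it meets every line up to that of `z`;
      -- the half from `z` to `x₁` ends in the last line and meets the remaining ones.
      foot j with ℕ.≤-total (toℕ j) (toℕ (f z))
      ... | inj₁ j≤fz =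
        let p , fp , _ , d = crosses (proj₁ (proj₂ halves))
              (subst (ℕ._≤ toℕ j) (sym (cong toℕ fx₀)) z≤n) j≤fz
        in p , fp , distance-mono G (ℕ.⌊n/2⌋≤⌈n/2⌉ l) d
      ... | inj₂ fz≤j =
        let p , fp , d , _ = crosses (proj₂ (proj₂ halves)) fz≤j
              (subst (toℕ j ℕ.≤_) (sym (trans (cong toℕ fx₁) (Fin.toℕ-fromℕ n))) (Fin.toℕ≤pred[n] j))
        in p , fp , distance-sym G d

      foot-near : ∀ j → DistanceAtMost G m (proj₁ (foot j)) z
      foot-near j = proj₂ (proj₂ (foot j))

      SphereOf : Fin (suc n) → ℕ → V → Set
      SphereOf j = Sphere (StepInto f j) (proj₁ (foot j))

      reach : ∀ j {t} → f t ≡ j → Star (StepInto f j) (proj₁ (foot j)) t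
      reach j {t} ft with foot j
      -- Matching `refl` turns `j` into `f p`, the index for which `connected` is stated.
      ... | p , refl , _ = connected (sym ft)

      sphere-nonempty : ∀ j i → i ℕ.≤ m → ∃ (SphereOf j i)
      sphere-nonempty j ℕ.zero  _ = proj₁ (foot j) , refl , λ ()
      sphere-nonempty j (suc i) i<m
        with sphere-or-component (StepInto f j) (proj₁ (foot j)) any? _≟_
               (λ x y → x ~? y ×-dec f y Fin.≟ j) i
      ... | inj₁ y      = y
      -- The ball of radius `i` fills the line, so the two ends of the line are at distance at most
      -- `i + i < l`: a forbidden `g`-crossing.
      ... | inj₂ filled =
        let t , ft , gt = point j zero
            b , fb , gb = point j (Fin.fromℕ n)
            _ , l≤ , w  = distance-trans G
                            (distance-sym G (ball⇒distance G proj₁ i (filled (reach j ft))))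
                            (ball⇒distance G proj₁ i (filled (reach j fb)))
        in contradiction (t , b , gt , gb , w) (no-shorter (ℕ.≤-<-trans l≤ (i<⌈l/2⌉⇒i+i<l i<m)))

      chosen : ∀ j (i : Fin (suc m)) → ∃ (SphereOf j (toℕ i))
      chosen j i = sphere-nonempty j (toℕ i) (Fin.toℕ≤pred[n] i)

      on-sphere : ∀ j i → SphereOf j (toℕ i) (proj₁ (chosen j i))
      on-sphere j i = proj₂ (chosen j i)

      ball-in-line : ∀ j r {y} → Ball (StepInto f j) (proj₁ (foot j)) r y → f y ≡ j
      ball-in-line j ℕ.zero  refl                     = proj₁ (proj₂ (foot j))
      ball-in-line j (suc r) (inj₁ b)                 = ball-in-line j r b
      ball-in-line j (suc r) (inj₂ (_ , _ , _ , fy)) = fy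

      line : Fin (suc n * suc m) → Fin (suc n)
      line = proj₁ ∘ remQuot {suc n} (suc m)

      height : Fin (suc n * suc m) → Fin (suc m)
      height = proj₂ ∘ remQuot {suc n} (suc m)

      choice : Fin (suc n * suc m) → V
      choice i = proj₁ (chosen (line i) (height i))

      same-height : ∀ {j j′ i i′} → j ≡ j′ → proj₁ (chosen j i) ≡ proj₁ (chosen j′ i′) → i ≡ i′
      same-height {j} {i = i} {i′} refl eq = Fin.toℕ-injective
        (sphere-radius-unique _ _ (on-sphere j i) (subst (SphereOf j (toℕ i′)) (sym eq) (on-sphere j i′)))

      same-line : ∀ {j j′ i i′} → proj₁ (chosen j i) ≡ proj₁ (chosen j′ i′) → j ≡ j′
      same-line {j} {j′} {i} {i′} eq = trans
        (sym (ball-in-line j (toℕ i) (proj₁ (on-sphere j i))))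
        (trans (cong f eq) (ball-in-line j′ (toℕ i′) (proj₁ (on-sphere j′ i′))))

      -- `f` recovers the line from the chosen vertex. Spheres of different radii around one foot
      -- are disjoint, which recovers the height.
      injective : ∀ {i i′} → choice i ≡ choice i′ → i ≡ i′
      injective {i} {i′} eq = trans (sym (Fin.combine-remQuot {suc n} (suc m) i))
        (trans (cong₂ combine j≡j′ (same-height {i = height i} {height i′} j≡j′ eq))
          (Fin.combine-remQuot {suc n} (suc m) i′))
        where
        j≡j′ : line i ≡ line i′
        j≡j′ = same-line {i = height i} {height i′} eq

-- Balls inside a subgraph, and the growth function.

module _ {G : FiniteGraph} (H : Subgraph G) where
  open FiniteGraph G using (order)
  open Subgraph H
  private module H = Graph (toGraph H)

  -- Membership proofs in a `Subset` are unique.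
  vertex-≡ : {x y : H.V} → x H.≈ y → x ≡ y
  vertex-≡ {x , p} {.x , q} refl = cong (x ,_) ([]=-irrelevant p q)

  vertex-≟ : DecidableEquality H.V
  vertex-≟ x y = map′ vertex-≡ (cong proj₁) (proj₁ x Fin.≟ proj₁ y)

  edge? : Decidable (Edge G N)
  edge? x y = y ∈? lookup N x

  vertex-search : Searchable H.V
  vertex-search {P} P? =
    map′ (λ (x , x∈W , p) → (x , x∈W) , p) (λ ((x , x∈W) , p) → x , x∈W , p)
         (Fin.any? λ x → at x (x ∈? W))
    where
    at : ∀ x → Dec (x ∈ W) → Dec (∃[ x∈W ] P (x , x∈W))
    at x (no x∉W)  = no (x∉W ∘ proj₁)
    at x (yes x∈W) = map′ (x∈W ,_)
      (λ (x∈W′ , p) → subst (λ x∈W → P (x , x∈W)) ([]=-irrelevant x∈W′ x∈W) p) (P? (x , x∈W))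

  module _ (z : H.V) (r : ℕ) where

    InBall : ℕ → Fin order → Set
    InBall = Ball (Edge G N) (proj₁ z)

    inBall? : U.Decidable (InBall r)
    inBall? = ball? (Edge G N) (proj₁ z) Fin.any? Fin._≟_ edge? r

    ball-edge? : ∀ x → U.Decidable (λ y → InBall r x × InBall r y × Edge G N x y)
    ball-edge? x y = inBall? x ×-dec inBall? y ×-dec edge? x y

    ball-edge⁺ : ∀ {x y} → InBall r x → InBall r y → Edge G N x y →
      Edge G (tabulate (⟦_⟧ ∘ ball-edge?)) x y
    ball-edge⁺ {x} {y} bx by e = subst (y ∈_) (sym (lookup∘tabulate (⟦_⟧ ∘ ball-edge?) x))
      (∈⟦⟧⁺ (ball-edge? x) (bx , by , e))

    ball-edge⁻ : ∀ {x y} → Edge G (tabulate (⟦_⟧ ∘ ball-edge?)) x y →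
      InBall r x × InBall r y × Edge G N x y
    ball-edge⁻ {x} {y} e =
      ∈⟦⟧⁻ (ball-edge? x) (subst (y ∈_) (lookup∘tabulate (⟦_⟧ ∘ ball-edge?) x) e)

    -- The subgraph of `H` induced on the ball, as `growth` ranges over subgraphs of `G`.
    ball : Subgraph G
    ball = mkSubgraph ⟦ inBall? ⟧ (tabulate (⟦_⟧ ∘ ball-edge?)) record
      { edge-sym = λ x y e → let bx , by , e′ = ball-edge⁻ e in ball-edge⁺ by bx (edge-sym x y e′)
      ; edge⇒∈   = λ x y e → ∈⟦⟧⁺ inBall? (proj₁ (ball-edge⁻ e))
      ; edge⇒~   = λ x y e → edge⇒~ x y (proj₂ (proj₂ (ball-edge⁻ e)))
      }

    ball-radius : RadiusAtMost (toGraph ball) r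
    ball-radius = (proj₁ z , ∈⟦⟧⁺ inBall? (ball-mono _ _ z≤n refl)) ,
      λ (y , y∈) → go ℕ.≤-refl (∈⟦⟧⁻ inBall? y∈)
      where
      -- The bound `s ≤ r` ensures that each vertex along the way lies in the ball of radius `r`, so
      -- the walk stays inside the subgraph.
      go : ∀ {s y z∈ y∈} → s ℕ.≤ r → InBall s y →
        DistanceAtMost (toGraph ball) s (proj₁ z , z∈) (y , y∈)
      go {ℕ.zero} _ refl = 0 , z≤n , stop refl
      go {suc s} s<r (inj₁ b) = distance-mono (toGraph ball) (ℕ.n≤1+n s) (go (ℕ.<⇒≤ s<r) b)
      go {suc s} s<r (inj₂ (x , b , e)) =
        distance-snoc (toGraph ball) {y = x , ∈⟦⟧⁺ inBall? bx} (go (ℕ.<⇒≤ s<r) b)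
          (ball-edge⁺ bx (ball-mono _ _ s<r (inj₂ (x , b , e))) e)
        where
        bx : InBall r x
        bx = ball-mono _ _ (ℕ.<⇒≤ s<r) b

    distance⇒ball : ∀ {y} → DistanceAtMost (toGraph H) r z y → InBall r (proj₁ y)
    distance⇒ball (l , l≤r , w) = ball-mono _ _ l≤r (go 0 refl w)
      where
      -- `Walk` recurses at its first step and `Ball` at its last, so `s` accumulates the steps
      -- already made.
      go : ∀ {l x y} s → InBall s (proj₁ x) → Walk H._≈_ H._~_ l x y → InBall (s ℕ.+ l) (proj₁ y)
      go {y = y} s b (stop refl) = subst (λ s → InBall s (proj₁ y)) (sym (ℕ.+-identityʳ s)) b
      go {y = y} s b (step {l} {y = x} e w) =
        subst (λ s → InBall s (proj₁ y)) (sym (ℕ.+-suc s l)) (go {x = x} (suc s) (inj₂ (_ , b , e)) w)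

  cluster≤growth : ∀ {q r} → Cluster (toGraph H) q r → q ℕ.≤ growth G r
  cluster≤growth {r = r} (z , y , y-inj , near) = ℕ.≤-trans
    (injection⇒≤∣p∣ (proj₁ ∘ y) (y-inj ∘ vertex-≡)
      (λ i → ∈⟦⟧⁺ (inBall? z r) (distance⇒ball z r {y i} (near i))))
    (growth-upper G r (ball z r) (ball-radius z r))

-- The rows and columns of a grid minor.

∣m-n∣≡1⇒n≤1+m : ∀ m n → ℕ.∣ m - n ∣ ≡ 1 → n ℕ.≤ suc m
∣m-n∣≡1⇒n≤1+m m n d = subst (n ℕ.≤_)
  (trans (cong (m ℕ.+_) (trans (ℕ.∣-∣-comm n m) d)) (ℕ.+-comm m 1))
  (ℕ.m≤n+∣m-n∣ n m)

path : ∀ {n} (i j : Fin n) → Star (λ i j → ℕ.∣ toℕ i - toℕ j ∣ ≡ 1) i j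
path {suc n} i j = reverse (λ {i} {j} → symm {i = i} {j}) (from-zero i) ◅◅ from-zero j
  where
  symm : ∀ {n} {i j : Fin n} → ℕ.∣ toℕ i - toℕ j ∣ ≡ 1 → ℕ.∣ toℕ j - toℕ i ∣ ≡ 1
  symm {i = i} {j} = trans (ℕ.∣-∣-comm (toℕ j) (toℕ i))
  from-zero : ∀ {n} (i : Fin (suc n)) → Star (λ i j → ℕ.∣ toℕ i - toℕ j ∣ ≡ 1) zero i
  from-zero         zero    = ε
  from-zero {suc n} (suc i) = refl ◅ gmap suc id (from-zero i)

module _ {G : FiniteGraph} {H : Subgraph G} {S : Rel (Graph.V (toGraph H)) 0ℓ}
         (S⇒~ : S ⇒ Graph._~_ (toGraph H)) {n : ℕ}
         (iso : grid (suc n) ≅ contract (toGraph H) S) where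
  open Graph (toGraph H) using (V; _~_)
  open _≅_ iso
  private
    module K = Graph (grid (suc n))
    module C = Graph (contract (toGraph H) S)
    module C≈ = Setoid C.vertices

  ≡⇒same-component : ∀ {x y} → from x ≡ from y → x C.≈ y
  ≡⇒same-component {x} {y} eq = C≈.trans (C≈.sym (strictlyInverseˡ x))
    (C≈.trans (C≈.reflexive (cong to eq)) (strictlyInverseˡ y))

  -- An edge of `H` either lies inside one component or joins two distinct ones, and then it
  -- witnesses their adjacency in the contraction.
  edge⇒≡⊎~ : ∀ {x y} → x ~ y → from x ≡ from y ⊎ from x K.~ from y
  edge⇒≡⊎~ {x} {y} e with ≡-dec Fin._≟_ Fin._≟_ (from x) (from y)
  ... | yes eq = inj₁ eq
  ... | no neq = inj₂ (Equivalence.from (~⇔~ (from x) (from y))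
    ( (λ c → neq (trans (sym (strictlyInverseʳ _)) (trans (from-cong c) (strictlyInverseʳ _))))
    , x , y , strictlyInverseˡ x , strictlyInverseˡ y , e ))

  -- π is one coordinate of the grid, ρ the other.
  module _ {π ρ : K.V → Fin (suc n)} (pt : Fin (suc n) → Fin (suc n) → K.V)
           (π-pt : ∀ j i → π (pt j i) ≡ j) (ρ-pt : ∀ j i → ρ (pt j i) ≡ i)
           (pt-η : ∀ v → pt (π v) (ρ v) ≡ v)
           (pt-~ : ∀ j {i i′} → ℕ.∣ toℕ i - toℕ i′ ∣ ≡ 1 → pt j i K.~ pt j i′)
           (π-~ : ∀ {u v} → u K.~ v → toℕ (π v) ℕ.≤ suc (toℕ (π u))) where

    -- Edges in `S` stay inside a component, and `from` sends a whole component to one grid vertex,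
    -- so every vertex passed has the same coordinate.
    component-connected : ∀ {j x y} → x C.≈ y → π (from x) ≡ j →
      Star (StepInto (toGraph H) (π ∘ from) j) x y
    component-connected ε _ = ε
    component-connected {x = x} (_◅_ {j = y} (fwd (inj₁ e)) ss) fx
      with refl ← vertex-≡ H {x} {y} e =
      component-connected ss fx
    component-connected {x = x} (_◅_ {j = y} (bwd (inj₁ e)) ss) fx
      with refl ← vertex-≡ H {y} {x} e =
      component-connected ss fx
    component-connected (s′@(fwd (inj₂ s)) ◅ ss) fx =
      (S⇒~ s , fy) ◅ component-connected ss fy
      where fy = trans (cong π (sym (from-cong (s′ ◅ ε)))) fx
    component-connected {x = x} (_◅_ {j = y} s′@(bwd (inj₂ s)) ss) fx =
      (Graph.~-sym (toGraph H) {y} {x} (S⇒~ s) , fy) ◅ component-connected ss fy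
      where fy = trans (cong π (sym (from-cong (s′ ◅ ε)))) fx

    from-to-pt : ∀ j i → π (from (to (pt j i))) ≡ j
    from-to-pt j i = trans (cong π (strictlyInverseʳ (pt j i))) (π-pt j i)

    -- Adjacency in the contraction supplies an edge of `H` between the two components: walk to its
    -- near end, cross it, and walk on inside the second component.
    adjacent-connected : ∀ j {i i′} → ℕ.∣ toℕ i - toℕ i′ ∣ ≡ 1 →
      Star (StepInto (toGraph H) (π ∘ from) j) (to (pt j i)) (to (pt j i′))
    adjacent-connected j {i} {i′} adj
      with _ , x , y , x∈ , y∈ , e ← Equivalence.to (~⇔~ (pt j i) (pt j i′)) (pt-~ j adj)
      = component-connected x∈ (from-to-pt j i)
        ◅◅ (e , fy) ◅ component-connected (C≈.sym y∈) fy
      where fy = trans (cong π (sym (from-cong y∈))) (from-to-pt j i′)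

    coordinate-lines : Lines (toGraph H) (π ∘ from) (ρ ∘ from)
    coordinate-lines = record
      { lipschitz = λ e →
          [ (λ eq → ℕ.m≤n⇒m≤1+n (ℕ.≤-reflexive (cong (toℕ ∘ π) (sym eq)))) , π-~ ]′ (edge⇒≡⊎~ e)
      ; connected = connected
      ; point     = λ j i → to (pt j i) , from-to-pt j i
                          , trans (cong ρ (strictlyInverseʳ (pt j i))) (ρ-pt j i)
      }
      where
      connected : ∀ {x y} → π (from x) ≡ π (from y) →
        Star (StepInto (toGraph H) (π ∘ from) (π (from x))) x y
      connected {x} {y} eq =
        -- Go from `x` to the representative of its component, along representatives of the line,
        -- and from the last of them to `y`.
        component-connected
          (≡⇒same-component (trans (sym (pt-η (from x))) (sym (strictlyInverseʳ _)))) refl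
        ◅◅ kleisliStar (to ∘ pt j) (adjacent-connected j) (path (ρ (from x)) (ρ (from y)))
        ◅◅ component-connected
             (≡⇒same-component (trans (strictlyInverseʳ _)
               (trans (cong (λ j → pt j (ρ (from y))) eq) (pt-η (from y)))))
             (from-to-pt j _)
        where
        j : Fin (suc n)
        j = π (from x)

  row-lines : Lines (toGraph H) (proj₁ ∘ from) (proj₂ ∘ from)
  row-lines = coordinate-lines _,_ (λ _ _ → refl) (λ _ _ → refl) (λ _ → refl)
    (λ _ adj → inj₁ (refl , adj))
    (λ { {u , _} (inj₁ (refl , _)) → ℕ.n≤1+n (toℕ u) ; (inj₂ (_ , d)) → ∣m-n∣≡1⇒n≤1+m _ _ d })

  column-lines : Lines (toGraph H) (proj₂ ∘ from) (proj₁ ∘ from)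
  column-lines = coordinate-lines (flip _,_) (λ _ _ → refl) (λ _ _ → refl) (λ _ → refl)
    (λ _ adj → inj₂ (refl , adj))
    (λ { {_ , u} (inj₂ (refl , _)) → ℕ.n≤1+n (toℕ u) ; (inj₁ (_ , d)) → ∣m-n∣≡1⇒n≤1+m _ _ d })

  -- Crossings exist, yet strong induction on the length excludes them in both directions: a
  -- shortest one would give a cluster larger than the growth permits.
  grid-minor⇒¬small-growth : .{{NonZero n}} →
    ¬ (∀ m .{{_ : NonZero m}} → growth G (m ℕ.+ m) ℕ.< suc n * suc m)
  grid-minor⇒¬small-growth small =
    let l , crossing = crossing-exists (toGraph H) column-lines in proj₁ (no-crossing l) crossing
    where
    refute : ∀ {f g : V → Fin (suc n)} l → Lines (toGraph H) f g →
      (∀ {l′} → l′ ℕ.< l → ¬ Crossing (toGraph H) g l′) → ¬ Crossing (toGraph H) f l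
    -- A walk of length zero cannot join opposite sides, since `n` is nonzero. Hence the radius
    -- passed to `small` below is positive.
    refute ℕ.zero lines no-shorter (x , y , fx , fy , stop e) with refl ← vertex-≡ H {x} {y} e =
      ℕ.≢-nonZero⁻¹ n (trans (sym (Fin.toℕ-fromℕ n)) (cong toℕ (trans (sym fy) fx)))
    refute (suc l) lines no-shorter c = ℕ.<⇒≱ (small ⌈ suc l /2⌉)
      (cluster≤growth H (shortest-crossing⇒cluster (toGraph H) (vertex-≡ H) (vertex-search H)
        (vertex-≟ H) (λ x y → edge? H (proj₁ x) (proj₁ y)) lines no-shorter c))

    no-crossing : ∀ l →
      ¬ Crossing (toGraph H) (proj₁ ∘ from) l × ¬ Crossing (toGraph H) (proj₂ ∘ from) l
    -- Both directions are treated together, because refuting one uses the absence of shorter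
    -- crossings in the other.
    no-crossing = <-rec _ λ l rec →
      refute l row-lines (proj₂ ∘ rec) , refute l column-lines (proj₁ ∘ rec)

-- From the real bound on the growth to a bound in natural numbers.

/1-mono-< : ∀ {m n} → m ℕ.< n → + m ℚ./ 1 ℚ.< + n ℚ./ 1
/1-mono-< {m} {n} m<n = ℚ.toℚᵘ-cancel-<
  (ℚᵘ.<-respˡ-≃ (ℚᵘ.≃-sym (ℚ.toℚᵘ-fromℚᵘ (ℚᵘ.mkℚᵘ (+ m) 0)))
    (ℚᵘ.<-respʳ-≃ (ℚᵘ.≃-sym (ℚ.toℚᵘ-fromℚᵘ (ℚᵘ.mkℚᵘ (+ n) 0)))
      (ℚᵘ.*<* (ℤ.*-monoʳ-<-pos (+ 1) (ℤ.+<+ m<n)))))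

-- On unnormalised rationals this becomes, after cross-multiplication, an identity of integers.
mk≡½k*2m : ∀ m k → + (m * k) ℚ./ 1 ≡ + k ℚ./ 1 ℚ.* ℚ.½ ℚ.* (+ (m ℕ.+ m) ℚ./ 1)
mk≡½k*2m m k = ℚ.toℚᵘ-injective (let open ℚᵘ.≃-Reasoning in begin
  ℚ.toℚᵘ (+ (m * k) ℚ./ 1)
    ≈⟨ ℚ.toℚᵘ-fromℚᵘ (ℚᵘ.mkℚᵘ (+ (m * k)) 0) ⟩
  ℚᵘ.mkℚᵘ (+ (m * k)) 0
    ≈⟨ ℚᵘ.*≡* crossed ⟩
  ℚᵘ.mkℚᵘ (+ k) 0 ℚᵘ.* ℚᵘ.½ ℚᵘ.* ℚᵘ.mkℚᵘ (+ (m ℕ.+ m)) 0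
    ≈⟨ ℚᵘ.*-cong (ℚᵘ.*-congʳ (ℚ.toℚᵘ-fromℚᵘ (ℚᵘ.mkℚᵘ (+ k) 0)))
                 (ℚ.toℚᵘ-fromℚᵘ (ℚᵘ.mkℚᵘ (+ (m ℕ.+ m)) 0)) ⟨
  ℚ.toℚᵘ (+ k ℚ./ 1) ℚᵘ.* ℚᵘ.½ ℚᵘ.* ℚ.toℚᵘ (+ (m ℕ.+ m) ℚ./ 1)
    ≈⟨ ℚᵘ.*-congʳ (ℚ.toℚᵘ-homo-* (+ k ℚ./ 1) ℚ.½) ⟨
  ℚ.toℚᵘ (+ k ℚ./ 1 ℚ.* ℚ.½) ℚᵘ.* ℚ.toℚᵘ (+ (m ℕ.+ m) ℚ./ 1)
    ≈⟨ ℚ.toℚᵘ-homo-* (+ k ℚ./ 1 ℚ.* ℚ.½) _ ⟨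
  ℚ.toℚᵘ (+ k ℚ./ 1 ℚ.* ℚ.½ ℚ.* (+ (m ℕ.+ m) ℚ./ 1))
    ∎)
  where
  open +-*-Solver
  crossed : + (m * k) ℤ.* + 2 ≡ + k ℤ.* + 1 ℤ.* + (m ℕ.+ m) ℤ.* + 1
  crossed = let open ≡-Reasoning in begin
    + (m * k) ℤ.* + 2
      ≡⟨ ℤ.pos-* (m * k) 2 ⟨
    + (m * k * 2)
      ≡⟨ cong +_ (solve 2 (λ m k → m :* k :* con 2 := k :* con 1 :* (m :+ m) :* con 1) refl m k) ⟩
    + (k * 1 * (m ℕ.+ m) * 1)
      ≡⟨ ℤ.pos-* (k * 1 * (m ℕ.+ m)) 1 ⟩
    + (k * 1 * (m ℕ.+ m)) ℤ.* + 1
      ≡⟨ cong (ℤ._* + 1) (ℤ.pos-* (k * 1) (m ℕ.+ m)) ⟩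
    + (k * 1) ℤ.* + (m ℕ.+ m) ℤ.* + 1
      ≡⟨ cong (λ i → i ℤ.* + (m ℕ.+ m) ℤ.* + 1) (ℤ.pos-* k 1) ⟩
    + k ℤ.* + 1 ℤ.* + (m ℕ.+ m) ℤ.* + 1
      ∎

-- If `m * k < g`, then `m * k` is in the lower cut of `(m + m) · c`, so `k / 2` is in that of `c`
-- and `k` in that of `2 · c`, whence `k < k`.
bound-from-halves : ∀ {c k g} → 2 · c ≤ fromℕ k →
  ∀ m .{{_ : NonZero m}} .{{_ : NonZero (m ℕ.+ m)}} → fromℕ g ≤ (m ℕ.+ m) · c → g ℕ.≤ m * k
bound-from-halves {c} {k} {g} 2c≤k m@(suc _) g≤2mc = ℕ.≮⇒≥ λ mk<g →
  ℚ.<-irrefl refl (2c≤k (+ k ℚ./ 1)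
    (subst (ℝ.L c) cancelled (g≤2mc (+ (m * k) ℚ./ 1) (/1-mono-< mk<g))))
  where
  2m : ℚ.ℚ
  2m = + (m ℕ.+ m) ℚ./ 1
  instance
    2m≢0 : ℚ.NonZero 2m
    2m≢0 = ℚ.pos⇒nonZero 2m {{ℚ.normalize-pos (m ℕ.+ m) 1}}
  cancelled : + (m * k) ℚ./ 1 ℚ.* ℚ.1/ 2m ≡ + k ℚ./ 1 ℚ.* ℚ.½
  cancelled = let a = + k ℚ./ 1 ℚ.* ℚ.½ in begin
    + (m * k) ℚ./ 1 ℚ.* ℚ.1/ 2m  ≡⟨ cong (ℚ._* ℚ.1/ 2m) (mk≡½k*2m m k) ⟩
    a ℚ.* 2m ℚ.* ℚ.1/ 2m         ≡⟨ ℚ.*-assoc a 2m (ℚ.1/ 2m) ⟩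
    a ℚ.* (2m ℚ.* ℚ.1/ 2m)       ≡⟨ cong (a ℚ.*_) (ℚ.*-inverseʳ 2m) ⟩
    a ℚ.* ℚ.1ℚ                   ≡⟨ ℚ.*-identityʳ a ⟩
    a                            ∎
    where open ≡-Reasoning

theorem9 : (c : ℝ) → fromℕ 1 ≤ c →
    (G : FiniteGraph) → ((r : ℕ) .{{_ : NonZero r}} → fromℕ (growth G r) ≤ r · c) →
    (k : ℕ) → IsCeiling (2 · c) (+ k) →
    ¬ (grid k MinorOf G)
theorem9 c 1≤c G growth≤ k (2c≤k , _) = at-least-2 k 2c≤k
  where
  1<k : ∀ {k} → 2 · c ≤ fromℕ k → ℚ.1ℚ ℚ.< + k ℚ./ 1
  -- Since `½ < 1 ≤ c`, the number `1` is in the lower cut of `2 · c`.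
  1<k 2c≤k = 2c≤k ℚ.1ℚ (1≤c ℚ.½ (ℚ.*<* (ℤ.+<+ (s≤s (s≤s z≤n)))))

  at-least-2 : ∀ k → 2 · c ≤ fromℕ k → ¬ (grid k MinorOf G)
  at-least-2 0 2c≤0 _ = ℚ.<-asym (1<k {0} 2c≤0) (/1-mono-< {0} {1} (s≤s z≤n))
  at-least-2 1 2c≤1 _ = ℚ.<-irrefl refl (1<k {1} 2c≤1)
  at-least-2 (suc k@(suc _)) 2c≤k (H , S , S⇒~ , iso) =
    -- With side `suc k`, the growth at `m + m` is at most `m * suc k`, which is less than
    -- `suc k * suc m`.
    grid-minor⇒¬small-growth {H = H} S⇒~ iso λ m → ℕ.≤-<-trans
      (bound-from-halves {c} {suc k} 2c≤k m {{it}} {{m+m≢0 m}} (growth≤ (m ℕ.+ m) {{m+m≢0 m}}))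
      (subst (ℕ._< suc k * suc m) (ℕ.*-comm (suc k) m) (ℕ.*-monoʳ-< (suc k) (ℕ.n<1+n m)))
    where
    m+m≢0 : ∀ m .{{_ : NonZero m}} → NonZero (m ℕ.+ m)
    m+m≢0 (suc _) = _
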